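{- On an input bipartite graph $G=(V=(L\cup R),E)$, the algorithm ExactBFC (described in the context) for counting the butterflies of $G$ has time complexity $O\left(\min\left(\sum_{u\in R}d_u^2,\ \sum_{v\in L}d_v^2\right)\right)$.
   Context: Graphs are finite, simple, bipartite, with vertex partition $V=L\cup R$, $E\subseteq L\times R$. $\Gamma_v$ is the set of neighbors of $v$, and $d_v=|\Gamma_v|$. A butterfly is a $2\times 2$ biclique. Let $\prec$ be a fixed total order on the vertices. The algorithm ExactBFC is: set $A\leftarrow L$, $b\leftarrow 0$; if $\sum_{u\in L}d_u^2<\sum_{v\in R}d_v^2$ then set $A\leftarrow R$. For each $v\in A$: create a hash map $C$ with all values zero; for each $u\in\Gamma_v$ and each $w\in\Gamma_u$ with $w\prec v$, set $C[w]\leftarrow C[w]+1$; then for each $w$ with $C[w]>0$ set $b\leftarrow b+\binom{C[w]}{2}$. Return $b$. Each hash map operation and arithmetic operation is counted as $O(1)$ time.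
   Formalization: The bound as stated fails for graphs with many isolated vertices (one edge plus k isolated vertices: the minimum is 1, the time at least k); it is proved for non-empty graphs without isolated vertices, and for all non-empty graphs with the number of isolated vertices added to the minimum. -}

module Defs where

open import Data.Bool using (Bool; if_then_else_)
open import Data.Fin using (Fin)
import Data.Fin.Properties as Fin
open import Data.List using (List; []; _∷_; _++_; map; filter; allFin; length)
open import Data.Nat using (ℕ; _+_; _*_; _^_; _⊓_; _≤_; _<_; _≟_; _<ᵇ_)
open import Data.Nat.ListAction using (sum)
open import Data.Nat.Combinatorics using () renaming (_C_ to _choose_)
open import Data.Product using (_×_; _,_; ∃-syntax)
open import Data.Sum using (_⊎_; inj₁; inj₂)
open import Data.Sum.Properties using (≡-dec)
open import Level using (0ℓ)
open import Relation.Binary.Core using (Rel; REL)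
open import Relation.Binary.Definitions using (Decidable; DecidableEquality)
open import Relation.Binary.PropositionalEquality using (_≡_)
open import Relation.Binary.Structures using (IsStrictTotalOrder)
open import Relation.Nullary using (does)

------------------------------------------------------------------------
-- Bipartite graphs

record BipartiteGraph : Set₁ where
  field
    |L| |R| : ℕ
    E       : REL (Fin |L|) (Fin |R|) 0ℓ
    E?      : Decidable E

  V : Set
  V = Fin |L| ⊎ Fin |R|

  L R : List V
  L = map inj₁ (allFin |L|)
  R = map inj₂ (allFin |R|)

  -- The neighbours of a vertex, each listed once.
  Γ : V → List V
  Γ (inj₁ i) = map inj₂ (filter (λ j → E? i j) (allFin |R|))
  Γ (inj₂ j) = map inj₁ (filter (λ i → E? i j) (allFin |L|))

  d : V → ℕ
  d v = length (Γ v)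

  Σd² : List V → ℕ
  Σd² vs = sum (map (λ v → d v ^ 2) vs)

  isolated : List V
  isolated = filter (λ v → d v ≟ 0) (L ++ R)

  NoIsolatedVertices : Set
  NoIsolatedVertices = ∀ v → 0 < d v

-- An input of ExactBFC: a graph together with the fixed order on its vertices.
record Input : Set₁ where
  field
    graph : BipartiteGraph

  open BipartiteGraph graph public

  infix 4 _≺_
  field
    _≺_                : Rel V 0ℓ
    isStrictTotalOrder : IsStrictTotalOrder _≡_ _≺_

  open IsStrictTotalOrder isStrictTotalOrder public
    using () renaming (_<?_ to _≺?_)

------------------------------------------------------------------------
-- Computations that accumulate their running time

record Timed (A : Set) : Set where
  constructor _after_
  field
    result : A
    time   : ℕ

open Timed public

infixl 1 _>>=_

return : {A : Set} → A → Timed A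
return x = x after 0

_>>=_ : {A B : Set} → Timed A → (A → Timed B) → Timed B
(x after s) >>= f = result (f x) after (s + time (f x))

-- "O(1) time" for a primitive operation: each kind of operation has its own
-- cost, a constant independent of the input.
record OperationCosts : Set where
  field
    arithmeticCost : ℕ   -- arithmetic operations and comparisons
    hashMapCost    : ℕ   -- creating, reading, writing, stepping through entries
    stepCost       : ℕ   -- assignments, loop control, reading a stored degree

------------------------------------------------------------------------
-- Hash maps with values in ℕ, every value being zero initially.
-- The list represents the contents only; the time of each operation is
-- the one charged by the algorithm below.

module HashMaps {K : Set} (_≟ᴷ_ : DecidableEquality K) where

  HashMap : Set
  HashMap = List (K × ℕ)

  empty : HashMap
  empty = []

  get : K → HashMap → ℕ
  get k []             = 0
  get k ((k′ , n) ∷ C) = if does (k ≟ᴷ k′) then n else get k C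

  set : K → ℕ → HashMap → HashMap
  set k m []             = (k , m) ∷ []
  set k m ((k′ , n) ∷ C) =
    if does (k ≟ᴷ k′) then (k , m) ∷ C else (k′ , n) ∷ set k m C

------------------------------------------------------------------------
-- The algorithm

module Algorithm (κ : OperationCosts) (I : Input) where

  open OperationCosts κ
  open Input I
  open HashMaps {V} (≡-dec Fin._≟_ Fin._≟_)

  arithmetic hashMap step : {A : Set} → A → Timed A
  arithmetic x = x after arithmeticCost
  hashMap    x = x after hashMapCost
  step       x = x after stepCost

  -- "For each x in the list", with the loop-carried state passed along.
  -- Every iteration and the final exit test cost one step.
  forEach : {A S : Set} → List A → S → (A → S → Timed S) → Timed S
  forEach []       s body = step s
  forEach (x ∷ xs) s body = do
    y  ← step x
    s′ ← body y s
    forEach xs s′ body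

  sumOfSquaredDegrees : List V → Timed ℕ
  sumOfSquaredDegrees vs = forEach vs 0 λ v s → do
    k  ← step (d v)
    k² ← arithmetic (k * k)
    arithmetic (s + k²)

  -- n (n - 1) / 2 takes three arithmetic operations.
  choose2 : ℕ → Timed ℕ
  choose2 n = (n choose 2) after (3 * arithmeticCost)

  increment : V → HashMap → Timed HashMap
  increment w C = do
    n  ← hashMap (get w C)
    n′ ← arithmetic (n + 1)
    hashMap (set w n′ C)

  countWedges : V → HashMap → Timed HashMap
  countWedges v C₀ =
    forEach (Γ v) C₀ λ u C₁ →
    forEach (Γ u) C₁ λ w C₂ → do
      w≺v ← arithmetic (does (w ≺? v))
      if w≺v then increment w C₂ else return C₂

  addButterflies : HashMap → ℕ → Timed ℕ
  addButterflies C b₀ = forEach C b₀ λ entry b → do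
    (_ , n)  ← hashMap entry
    positive ← arithmetic (0 <ᵇ n)
    if positive
      then (do k ← choose2 n
               arithmetic (b + k))
      else return b

  exactBFC : Timed ℕ
  exactBFC = do
    A₀   ← step L
    b₀   ← step 0
    σL   ← sumOfSquaredDegrees L
    σR   ← sumOfSquaredDegrees R
    less ← arithmetic (σL <ᵇ σR)
    A    ← step (if less then R else A₀)
    forEach A b₀ λ v b → do
      C₀ ← hashMap empty
      C  ← countWedges v C₀
      addButterflies C b

runningTime : OperationCosts → Input → ℕ
runningTime κ I = time (Algorithm.exactBFC κ I)

------------------------------------------------------------------------
-- Bounds

minΣd² : Input → ℕ
minΣd² I = Σd² R ⊓ Σd² L
  where open Input I

isolatedCount : Input → ℕ
isolatedCount I = length (Input.isolated I)

-- f = O(g) over the inputs satisfying P.  Inputs with g = 0 are left out, since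
-- no positive running time is at most c * 0.  For the two bounds used, these are the
-- graphs without vertices.
BigO : (P : Input → Set) (f g : Input → ℕ) → Set₁
BigO P f g = ∃[ c ] (∀ I → P I → 0 < g I → f I ≤ c * g I)

{-# OPTIONS --safe #-}

-- A wedge v – u – w with v in the chosen side A is examined once for every
-- v ∈ A, u ∈ Γ v and w ∈ Γ u, so by double counting over the edges the loops make
-- ∑_{v ∈ A} ∑_{u ∈ Γ v} d u = ∑_u (d u)² inner iterations, u ranging over the side
-- opposite to A, and A is chosen so that this is the minimum.  The hash map of v has at
-- most one entry per wedge.  All remaining work is linear in the number of edges
-- ∑_L d = ∑_R d ≤ min (Σd² L) (Σd² R) and of vertices; each vertex is isolated or
-- the end of an edge, so there are at most 2 |E| + isolatedCount of them.
module Submission where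

open import Defs
open import Data.Bool using (Bool; true; false; if_then_else_; T)
import Data.Fin.Properties as Fin
open import Data.List using (List; []; _∷_; _++_; map; filter; allFin; length)
open import Data.List.Properties
  using (length-map; length-++; map-++; map-∘; map-cong; filter-none)
open import Data.List.Relation.Unary.All using (universal)
open import Data.Nat
  using (ℕ; zero; suc; _+_; _*_; _^_; _⊓_; _≤_; _<_; _≟_; _<ᵇ_; z≤n; s≤s; >-nonZero)
open import Data.Nat.ListAction using (sum)
open import Data.Nat.ListAction.Properties using (sum-++)
open import Data.Nat.Properties
open import Data.Nat.Tactic.RingSolver using (solve-∀)
open import Data.Product using (_×_; _,_)
open import Data.Sum using (inj₁; inj₂)
open import Data.Sum.Properties using (≡-dec)
open import Data.Unit using (⊤; tt)
open import Function using (_∘_)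
open import Level using (0ℓ)
open import Relation.Binary.Core using (REL)
open import Relation.Binary.Definitions using (Decidable)
open import Relation.Binary.PropositionalEquality
  using (_≡_; refl; sym; trans; cong; subst; module ≡-Reasoning)
open import Relation.Nullary using (does)

-- Sums over lists

∑ : {A : Set} → List A → (A → ℕ) → ℕ
∑ xs f = sum (map f xs)

module _ {A : Set} where

  ∑-cong : ∀ xs {f g : A → ℕ} → (∀ x → f x ≡ g x) → ∑ xs f ≡ ∑ xs g
  ∑-cong xs f≗g = cong sum (map-cong f≗g xs)

  ∑-mono : ∀ xs {f g : A → ℕ} → (∀ x → f x ≤ g x) → ∑ xs f ≤ ∑ xs g
  ∑-mono []       f≤g = z≤n
  ∑-mono (x ∷ xs) f≤g = +-mono-≤ (f≤g x) (∑-mono xs f≤g)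

  ∑-++ : ∀ xs ys (f : A → ℕ) → ∑ (xs ++ ys) f ≡ ∑ xs f + ∑ ys f
  ∑-++ xs ys f = trans (cong sum (map-++ f xs ys)) (sum-++ (map f xs) (map f ys))

  ∑-const : ∀ (xs : List A) c → ∑ xs (λ _ → c) ≡ length xs * c
  ∑-const []       c = refl
  ∑-const (x ∷ xs) c = cong (c +_) (∑-const xs c)

  ∑-affine : ∀ xs c p q (f g : A → ℕ) →
    ∑ xs (λ x → c + (p * f x + q * g x)) ≡ length xs * c + (p * ∑ xs f + q * ∑ xs g)
  ∑-affine []       c p q f g = base p q
    where
    base : ∀ p q → 0 ≡ p * 0 + q * 0
    base = solve-∀
  ∑-affine (x ∷ xs) c p q f g
    rewrite ∑-affine xs c p q f g
    = step (length xs) c p q (f x) (g x) (∑ xs f) (∑ xs g)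
    where
    step : ∀ n c p q y z Y Z → (c + (p * y + q * z)) + (n * c + (p * Y + q * Z)) ≡
                               (c + n * c) + (p * (y + Y) + q * (z + Z))
    step = solve-∀

  ∑-map : ∀ {B : Set} (h : B → A) xs (f : A → ℕ) → ∑ (map h xs) f ≡ ∑ xs (f ∘ h)
  ∑-map h xs f = cong sum (sym (map-∘ xs))

-- Double counting over a decidable relation

module _ {A B : Set} {P : REL A B 0ℓ} (P? : Decidable P) (f : B → ℕ) where

  private
    related : List A → B → ℕ
    related xs y = length (filter (λ x → P? x y) xs)

    -- Prepending `x` raises `related xs y` by one exactly for those `y` that pass the filter, and
    -- their extra terms `f y` make up the first sum.
    ∑-related : ∀ x xs ys →
      ∑ (filter (P? x) ys) f + ∑ ys (λ y → related xs y * f y) ≡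
      ∑ ys (λ y → related (x ∷ xs) y * f y)
    ∑-related x xs []       = refl
    ∑-related x xs (y ∷ ys) with ih ← ∑-related x xs ys | does (P? x y)
    ... | true  = trans (swap (f y) (∑ (filter (P? x) ys) f) (related xs y * f y) _)
                        (cong ((f y + related xs y * f y) +_) ih)
      where
      swap : ∀ a b c e → (a + b) + (c + e) ≡ (a + c) + (b + e)
      swap = solve-∀
    ... | false = trans (swap (∑ (filter (P? x) ys) f) (related xs y * f y) _)
                        (cong (related xs y * f y +_) ih)
      where
      swap : ∀ b c e → b + (c + e) ≡ c + (b + e)
      swap = solve-∀

  -- Both sides sum `f y` over all related pairs, grouped by `x` or by `y`. The relation is
  -- arbitrary so that the edge relation can also be used transposed.
  ∑-double-counting : ∀ xs ys →
    ∑ xs (λ x → ∑ (filter (P? x) ys) f) ≡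
    ∑ ys (λ y → length (filter (λ x → P? x y) xs) * f y)
  ∑-double-counting []       ys = sym (trans (∑-const ys 0) (*-zeroʳ (length ys)))
  ∑-double-counting (x ∷ xs) ys =
    trans (cong (∑ (filter (P? x) ys) f +_) (∑-double-counting xs ys))
          (∑-related x xs ys)

-- Degrees in bipartite graphs

module Degrees (G : BipartiteGraph) where

  open BipartiteGraph G

  -- Each `u` in `R` lies in `Γ v` for exactly `d u` vertices `v` of `L`. The weight `d` yields the
  -- wedge count, the weight 1 the edge count.
  ∑-Γ-L : ∀ f → ∑ L (λ v → ∑ (Γ v) f) ≡ ∑ R (λ u → d u * f u)
  ∑-Γ-L f = begin
    ∑ L (λ v → ∑ (Γ v) f)
      ≡⟨ ∑-map inj₁ (allFin |L|) _ ⟩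
    ∑ (allFin |L|) (λ i → ∑ (Γ (inj₁ i)) f)
      ≡⟨ ∑-cong (allFin |L|) (λ i → ∑-map inj₂ (filter (E? i) (allFin |R|)) f) ⟩
    ∑ (allFin |L|) (λ i → ∑ (filter (E? i) (allFin |R|)) (f ∘ inj₂))
      ≡⟨ ∑-double-counting E? (f ∘ inj₂) (allFin |L|) (allFin |R|) ⟩
    ∑ (allFin |R|) (λ j → length (filter (λ i → E? i j) (allFin |L|)) * f (inj₂ j))
      ≡⟨ ∑-cong (allFin |R|) (λ j → cong (_* f (inj₂ j)) (length-map inj₁ (filter (λ i → E? i j) (allFin |L|)))) ⟨
    ∑ (allFin |R|) (λ j → d (inj₂ j) * f (inj₂ j))
      ≡⟨ ∑-map inj₂ (allFin |R|) _ ⟨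
    ∑ R (λ u → d u * f u)
      ∎
    where open ≡-Reasoning

  ∑-Γ-R : ∀ f → ∑ R (λ v → ∑ (Γ v) f) ≡ ∑ L (λ u → d u * f u)
  ∑-Γ-R f = begin
    ∑ R (λ v → ∑ (Γ v) f)
      ≡⟨ ∑-map inj₂ (allFin |R|) _ ⟩
    ∑ (allFin |R|) (λ j → ∑ (Γ (inj₂ j)) f)
      ≡⟨ ∑-cong (allFin |R|) (λ j → ∑-map inj₁ (filter (λ i → E? i j) (allFin |L|)) f) ⟩
    ∑ (allFin |R|) (λ j → ∑ (filter (λ i → E? i j) (allFin |L|)) (f ∘ inj₁))
      ≡⟨ ∑-double-counting (λ j i → E? i j) (f ∘ inj₁) (allFin |R|) (allFin |L|) ⟩
    ∑ (allFin |L|) (λ i → length (filter (E? i) (allFin |R|)) * f (inj₁ i))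
      ≡⟨ ∑-cong (allFin |L|) (λ i → cong (_* f (inj₁ i)) (length-map inj₂ (filter (E? i) (allFin |R|)))) ⟨
    ∑ (allFin |L|) (λ i → d (inj₁ i) * f (inj₁ i))
      ≡⟨ ∑-map inj₁ (allFin |L|) _ ⟨
    ∑ L (λ u → d u * f u)
      ∎
    where open ≡-Reasoning

  n*n≡n^2 : ∀ n → n * n ≡ n ^ 2
  n*n≡n^2 n = cong (n *_) (sym (*-identityʳ n))

  -- The number of two-edge walks starting in `A`, those returning to their start included.
  ∑W : List V → ℕ
  ∑W A = ∑ A (λ v → ∑ (Γ v) d)

  ∑W-L : ∑W L ≡ Σd² R
  ∑W-L = trans (∑-Γ-L d) (∑-cong R (n*n≡n^2 ∘ d))

  ∑W-R : ∑W R ≡ Σd² L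
  ∑W-R = trans (∑-Γ-R d) (∑-cong L (n*n≡n^2 ∘ d))

  ∑d-L≡∑d-R : ∑ L d ≡ ∑ R d
  ∑d-L≡∑d-R = begin
    ∑ L d                          ≡⟨ ∑-cong L (λ v → trans (∑-const (Γ v) 1) (*-identityʳ (d v))) ⟨
    ∑ L (λ v → ∑ (Γ v) (λ _ → 1))  ≡⟨ ∑-Γ-L (λ _ → 1) ⟩
    ∑ R (λ u → d u * 1)            ≡⟨ ∑-cong R (*-identityʳ ∘ d) ⟩
    ∑ R d                          ∎
    where open ≡-Reasoning

  ∑d≤Σd² : ∀ vs → ∑ vs d ≤ Σd² vs
  ∑d≤Σd² vs = ∑-mono vs (λ v → n≤n^2 (d v))
    where
    n≤n^2 : ∀ n → n ≤ n ^ 2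
    n≤n^2 zero      = z≤n
    n≤n^2 n@(suc _) = ≤-trans (m≤m*n n n) (≤-reflexive (n*n≡n^2 n))

  -- Since both degree sums equal the number of edges, each is bounded by the squares of either
  -- side.
  ∑d-L≤min : ∑ L d ≤ Σd² R ⊓ Σd² L
  ∑d-L≤min = ⊓-glb (≤-trans (≤-reflexive ∑d-L≡∑d-R) (∑d≤Σd² R)) (∑d≤Σd² L)

  ∑d-R≤min : ∑ R d ≤ Σd² R ⊓ Σd² L
  ∑d-R≤min = ≤-trans (≤-reflexive (sym ∑d-L≡∑d-R)) ∑d-L≤min

  -- Every vertex contributes at least 1 on the right: to the isolated count if its degree is zero,
  -- to the degree sum otherwise.
  length≤isolated+∑d : ∀ vs → length vs ≤ length (filter (λ v → d v ≟ 0) vs) + ∑ vs d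
  length≤isolated+∑d []       = z≤n
  length≤isolated+∑d (v ∷ vs) with ih ← length≤isolated+∑d vs | d v
  ... | zero  = s≤s ih
  ... | suc k = begin
    suc (length vs)               ≤⟨ s≤s ih ⟩
    suc (z + ∑ vs d)              ≡⟨ +-suc z (∑ vs d) ⟨
    z + suc (∑ vs d)              ≤⟨ +-monoʳ-≤ z (s≤s (m≤n+m (∑ vs d) k)) ⟩
    z + (suc k + ∑ vs d)          ∎
    where
    open ≤-Reasoning
    z = length (filter (λ v → d v ≟ 0) vs)

  vertices≤ : length L + length R ≤ 2 * ((Σd² R ⊓ Σd² L) + length isolated)
  vertices≤ = begin
    length L + length R             ≡⟨ length-++ L ⟨
    length (L ++ R)                 ≤⟨ length≤isolated+∑d (L ++ R) ⟩
    i + ∑ (L ++ R) d                ≡⟨ cong (i +_) (∑-++ L R d) ⟩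
    -- The two degree sums cost `m` each; `i` is doubled merely to obtain a multiple of `m + i`.
    i + (∑ L d + ∑ R d)             ≤⟨ +-mono-≤ (m≤m+n i i) (+-mono-≤ ∑d-L≤min ∑d-R≤min) ⟩
    (i + i) + (m + m)               ≡⟨ double i m ⟩
    2 * (m + i)                     ∎
    where
    open ≤-Reasoning
    i = length isolated
    m = Σd² R ⊓ Σd² L
    double : ∀ i m → (i + i) + (m + m) ≡ 2 * (m + i)
    double = solve-∀

-- Running times

module Costs (κ : OperationCosts) where

  open OperationCosts κ renaming (arithmeticCost to a; hashMapCost to h; stepCost to s) public

  -- Worst cases of one iteration, its loop step included. In `entryCost`, `3 * a` pays for the
  -- binomial coefficient; in `vertexCost`, the last two `s` pay for the exit tests of the loops
  -- over neighbours and over map entries.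
  wedgeCost entryCost vertexCost : ℕ
  wedgeCost  = s + (a + (h + (a + h)))
  entryCost  = s + (h + (a + (3 * a + a)))
  vertexCost = s + (h + (s + s))

  -- In order: the fixed overhead; the degree sums and then the main loop, each over at most `2 * g`
  -- vertices; the two steps per edge of the loop over neighbours; the wedges and map entries.
  constantFactor : ℕ
  constantFactor = (6 * s + a) + 2 * (s + (s + (a + a)))
                 + 2 * vertexCost + 2 * s + (wedgeCost + entryCost)

module RunningTime (κ : OperationCosts) (I : Input) where

  open Costs κ
  open Input I
  open Degrees graph
  open Algorithm κ I
  open HashMaps {V} (≡-dec Fin._≟_ Fin._≟_)
  open ≤-Reasoning

  -- Time and state growth of loops

  module _ {A S : Set} {body : A → S → Timed S} where

    forEach-time : (f : A → ℕ) → (∀ x t → time (body x t) ≤ f x) →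
      ∀ xs t → time (forEach xs t body) ≤ s + ∑ xs (λ x → s + f x)
    forEach-time f body≤ []       t = ≤-reflexive (sym (+-identityʳ s))
    forEach-time f body≤ (x ∷ xs) t = begin
      s + (time (body x t) + time (forEach xs (result (body x t)) body))
        ≤⟨ +-monoʳ-≤ s (+-mono-≤ (body≤ x t) (forEach-time f body≤ xs _)) ⟩
      s + (f x + (s + ∑ xs (λ x → s + f x)))
        ≡⟨ shuffle s (f x) _ ⟩
      s + (s + f x + ∑ xs (λ x → s + f x))
        ∎
      where
      shuffle : ∀ s y z → s + (y + (s + z)) ≡ s + (s + y + z)
      shuffle = solve-∀

    forEach-time-const : ∀ c → (∀ x t → time (body x t) ≤ c) →
      ∀ xs t → time (forEach xs t body) ≤ s + length xs * (s + c)
    forEach-time-const c body≤ xs t =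
      ≤-trans (forEach-time (λ _ → c) body≤ xs t) (≤-reflexive (cong (s +_) (∑-const xs (s + c))))

    -- `φ` measures the loop state; it is used with the number of hash map entries.
    forEach-growth : (φ : S → ℕ) (g : A → ℕ) → (∀ x t → φ (result (body x t)) ≤ φ t + g x) →
      ∀ xs t → φ (result (forEach xs t body)) ≤ φ t + ∑ xs g
    forEach-growth φ g grow []       t = m≤m+n (φ t) 0
    forEach-growth φ g grow (x ∷ xs) t = begin
      φ (result (forEach xs (result (body x t)) body)) ≤⟨ forEach-growth φ g grow xs _ ⟩
      φ (result (body x t)) + ∑ xs g                   ≤⟨ +-monoˡ-≤ (∑ xs g) (grow x t) ⟩
      φ t + g x + ∑ xs g                               ≡⟨ +-assoc (φ t) (g x) _ ⟩
      φ t + (g x + ∑ xs g)                             ∎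

  forEach-sum : {A : Set} {body : A → ℕ → Timed ℕ} (f : A → ℕ) →
    (∀ x t → result (body x t) ≡ t + f x) →
    ∀ xs t → result (forEach xs t body) ≡ t + ∑ xs f
  forEach-sum f adds []       t = sym (+-identityʳ t)
  forEach-sum {body = body} f adds (x ∷ xs) t =
    trans (forEach-sum f adds xs (result (body x t)))
          (trans (cong (_+ ∑ xs f) (adds x t)) (+-assoc t (f x) (∑ xs f)))

  -- The exact value matters because the choice of side, and hence the running time, depends on it.
  sumOfSquaredDegrees-result : ∀ vs → result (sumOfSquaredDegrees vs) ≡ Σd² vs
  sumOfSquaredDegrees-result vs =
    forEach-sum (λ v → d v ^ 2) (λ v t → cong (t +_) (n*n≡n^2 (d v))) vs 0

  sumOfSquaredDegrees-time : ∀ vs →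
    time (sumOfSquaredDegrees vs) ≤ s + length vs * (s + (s + (a + a)))
  sumOfSquaredDegrees-time vs =
    forEach-time-const (s + (a + a)) (λ _ _ → ≤-refl) vs 0

  -- Wedge counting and the size of the hash map

  length-set : ∀ k m C → length (set k m C) ≤ length C + 1
  length-set k m []             = ≤-refl
  length-set k m ((k′ , n) ∷ C) with does (≡-dec Fin._≟_ Fin._≟_ k k′)
  ... | true  = m≤m+n _ 1
  ... | false = s≤s (length-set k m C)

  countWedges-time : ∀ v C →
    time (countWedges v C) ≤ s + ∑ (Γ v) (λ u → s + (s + d u * wedgeCost))
  countWedges-time v = forEach-time _
    (λ u → forEach-time-const _ inner (Γ u)) (Γ v)
    where
    inner : ∀ w C → a + time (if does (w ≺? v) then increment w C else return C)
                    ≤ a + (h + (a + h))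
    inner w C with does (w ≺? v)
    ... | true  = ≤-refl
    ... | false = +-monoʳ-≤ a z≤n

  -- Each wedge creates at most one entry, which limits the later loop over entries.
  countWedges-length : ∀ v C → length (result (countWedges v C)) ≤ length C + ∑ (Γ v) d
  countWedges-length v = forEach-growth length d
    (λ u C → ≤-trans (forEach-growth length (λ _ → 1) inner (Γ u) C)
                     (≤-reflexive (cong (length C +_) (trans (∑-const (Γ u) 1) (*-identityʳ (d u))))))
    (Γ v)
    where
    inner : ∀ w C → length (result (if does (w ≺? v) then increment w C else return C))
                    ≤ length C + 1
    inner w C with does (w ≺? v)
    ... | true  = length-set w _ C
    ... | false = m≤m+n _ 1

  addButterflies-time : ∀ C b → time (addButterflies C b) ≤ s + length C * entryCost
  addButterflies-time = forEach-time-const _ entry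
    where
    entry : ∀ ((w , n) : V × ℕ) b →
      h + (a + time (if 0 <ᵇ n then (choose2 n >>= λ k → arithmetic (b + k)) else return b))
      ≤ h + (a + (3 * a + a))
    entry (w , n) b with 0 <ᵇ n
    ... | true  = ≤-refl
    ... | false = +-monoʳ-≤ h (+-monoʳ-≤ a z≤n)

  -- The main loop of `exactBFC`, isolated so that it can be bounded for either side.
  countAll : List V → ℕ → Timed ℕ
  countAll A b₀ = forEach A b₀ λ v b →
    hashMap empty >>= λ C₀ → countWedges v C₀ >>= λ C → addButterflies C b

  countAll-time : ∀ A b → time (countAll A b) ≤
    s + (length A * vertexCost + (2 * s * ∑ A d + (wedgeCost + entryCost) * ∑W A))
  countAll-time A b = begin
    time (countAll A b)
      ≤⟨ forEach-time perVertex (λ v b → +-monoʳ-≤ h (vertex v b)) A b ⟩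
    s + ∑ A (λ v → s + perVertex v)
      ≡⟨ cong (s +_) (∑-cong A affine) ⟩
    s + ∑ A (λ v → vertexCost + (2 * s * d v + (wedgeCost + entryCost) * ∑ (Γ v) d))
      ≡⟨ cong (s +_) (∑-affine A vertexCost (2 * s) (wedgeCost + entryCost) d _) ⟩
    s + (length A * vertexCost + (2 * s * ∑ A d + (wedgeCost + entryCost) * ∑W A))
      ∎
    where
    perVertex : V → ℕ
    perVertex v = h + ((s + ∑ (Γ v) (λ u → s + (s + d u * wedgeCost)))
                       + (s + ∑ (Γ v) d * entryCost))

    vertex : ∀ v b → time (countWedges v empty)
                     + time (addButterflies (result (countWedges v empty)) b)
                   ≤ (s + ∑ (Γ v) (λ u → s + (s + d u * wedgeCost)))
                     + (s + ∑ (Γ v) d * entryCost)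
    vertex v b = +-mono-≤ (countWedges-time v empty)
      (≤-trans (addButterflies-time (result (countWedges v empty)) b)
               (+-monoʳ-≤ s (*-monoˡ-≤ entryCost (countWedges-length v empty))))

    expand : ∀ s x q → s + (s + x * q) ≡ 2 * s + q * x
    expand = solve-∀

    regroup : ∀ s h n W q e →
      s + (h + ((s + (n * (2 * s) + q * W)) + (s + W * e)))
      ≡ (s + (h + (s + s))) + (2 * s * n + (q + e) * W)
    regroup = solve-∀

    affine : ∀ v → s + perVertex v ≡
                   vertexCost + (2 * s * d v + (wedgeCost + entryCost) * ∑ (Γ v) d)
    affine v = trans
      (cong (λ x → s + (h + ((s + x) + (s + ∑ (Γ v) d * entryCost)))) inner)
      (regroup s h (d v) (∑ (Γ v) d) wedgeCost entryCost)
      where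
      inner : ∑ (Γ v) (λ u → s + (s + d u * wedgeCost))
            ≡ d v * (2 * s) + wedgeCost * ∑ (Γ v) d
      inner = trans (∑-cong (Γ v) (λ u → expand s (d u) wedgeCost))
                    -- The coefficient 0 removes the first sum, leaving the constant and the degree
                    -- sum.
                    (∑-affine (Γ v) (2 * s) 0 wedgeCost (λ _ → 0) d)

  -- The chosen side and the total bound

  m g : ℕ
  m = minΣd² I
  g = m + isolatedCount I

  countAll-time≤ : ∀ A b → length A ≤ 2 * g → ∑ A d ≤ m → ∑W A ≤ m →
    time (countAll A b) ≤
    s + (2 * g * vertexCost + (2 * s * g + (wedgeCost + entryCost) * g))
  countAll-time≤ A b A≤ d≤ W≤ = ≤-trans (countAll-time A b) (+-monoʳ-≤ s
    (+-mono-≤ (*-monoˡ-≤ vertexCost A≤)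
      (+-mono-≤ (*-monoʳ-≤ (2 * s) (≤-trans d≤ (m≤m+n m _)))
                (*-monoʳ-≤ (wedgeCost + entryCost) (≤-trans W≤ (m≤m+n m _))))))

  chosenSide : List V
  chosenSide = if Σd² L <ᵇ Σd² R then R else L

  chosenSide-time : ∀ b → time (countAll chosenSide b) ≤
    s + (2 * g * vertexCost + (2 * s * g + (wedgeCost + entryCost) * g))
  chosenSide-time b with Σd² L <ᵇ Σd² R in eq
  -- Wedges starting in one side total the squares of the other, so `R` is the right choice when
  -- `Σd² L` is the smaller sum.
  ... | true  = countAll-time≤ R b (≤-trans (m≤n+m _ (length L)) vertices≤) ∑d-R≤min
    (≤-reflexive (trans ∑W-R (sym (m≥n⇒m⊓n≡n (<⇒≤ (<ᵇ⇒< _ _ (subst T (sym eq) tt)))))))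
  ... | false = countAll-time≤ L b (≤-trans (m≤m+n _ (length R)) vertices≤) ∑d-L≤min
    (≤-reflexive (trans ∑W-L (sym (m≤n⇒m⊓n≡m (≮⇒≥ (λ L<R → subst T eq (<⇒<ᵇ L<R)))))))

  exactBFC-time : 0 < g → time exactBFC ≤ constantFactor * g
  exactBFC-time 0<g
    -- Replacing the computed sums by `Σd²` turns the branch of the algorithm into `chosenSide`.
    rewrite sumOfSquaredDegrees-result L | sumOfSquaredDegrees-result R = begin
    s + (s + (time (sumOfSquaredDegrees L) + (time (sumOfSquaredDegrees R)
      + (a + (s + time (countAll chosenSide 0))))))
      ≤⟨ +-monoʳ-≤ s (+-monoʳ-≤ s (+-mono-≤ (sumOfSquaredDegrees-time L)
           (+-mono-≤ (sumOfSquaredDegrees-time R)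
             (+-monoʳ-≤ a (+-monoʳ-≤ s (chosenSide-time 0)))))) ⟩
    s + (s + ((s + length L * p) + ((s + length R * p) + (a + (s + (s + loop))))))
      ≡⟨ collect s a p (length L) (length R) loop ⟩
    (6 * s + a) + ((length L + length R) * p + loop)
      -- The fixed overhead is absorbed into a multiple of `g` because `g` is positive.
      ≤⟨ +-mono-≤ (m≤m*n (6 * s + a) g {{>-nonZero 0<g}})
                  (+-monoˡ-≤ loop (*-monoˡ-≤ p vertices≤)) ⟩
    (6 * s + a) * g + (2 * g * p + loop)
      ≡⟨ factor (6 * s + a) p vertexCost (2 * s) (wedgeCost + entryCost) g ⟩
    constantFactor * g
      ∎
    where
    p = s + (s + (a + a))
    loop = 2 * g * vertexCost + (2 * s * g + (wedgeCost + entryCost) * g)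

    collect : ∀ s a p l r t →
      s + (s + ((s + l * p) + ((s + r * p) + (a + (s + (s + t))))))
      ≡ (6 * s + a) + ((l + r) * p + t)
    collect = solve-∀

    factor : ∀ k p v t w g →
      k * g + (2 * g * p + (2 * g * v + (t * g + w * g)))
      ≡ (k + 2 * p + 2 * v + t + w) * g
    factor = solve-∀

noIsolated⇒isolatedCount≡0 : ∀ I → Input.NoIsolatedVertices I → isolatedCount I ≡ 0
noIsolated⇒isolatedCount≡0 I 0<d =
  cong length (filter-none (λ v → d v ≟ 0) (universal (λ v → >⇒≢ (0<d v)) (L ++ R)))
  where open Input I

mainTheorem3 : (κ : OperationCosts) →
    BigO (λ I → Input.NoIsolatedVertices I) (runningTime κ) minΣd²
    × BigO (λ _ → ⊤) (runningTime κ) (λ I → minΣd² I + isolatedCount I)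
mainTheorem3 κ =
  (Costs.constantFactor κ , withoutIsolated) ,
  (Costs.constantFactor κ , λ I _ → RunningTime.exactBFC-time κ I)
  where
  withoutIsolated : ∀ I → Input.NoIsolatedVertices I → 0 < minΣd² I →
    runningTime κ I ≤ Costs.constantFactor κ * minΣd² I
  withoutIsolated I 0<d =
    -- The general bound is transported along the equality of the two bounds when no vertex is
    -- isolated.
    subst (λ g → 0 < g → runningTime κ I ≤ Costs.constantFactor κ * g)
          (trans (cong (minΣd² I +_) (noIsolated⇒isolatedCount≡0 I 0<d)) (+-identityʳ _))
          (RunningTime.exactBFC-time κ I)
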